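{- There exists a finite set $U$ of non-negative integers with $0\in U$ such that $$1+\frac{\log\left(\frac{|U-U|}{|U+U|}\right)}{\log\left(2\max(U)+1\right)}\;\geq\; 1.173050 .$$ Consequently, for the sums and differences of sets problem, the exponent $\theta$ (defined in the context) satisfies $\theta\geq 1.173050$.
   Context: For finite sets of integers $X,Y$, write $X+Y=\{x+y: x\in X, y\in Y\}$ and $X-Y=\{x-y: x\in X, y\in Y\}$; $|X|$ denotes cardinality. Sums and differences of sets problem: for a real number $K>1$, $\theta$ denotes the largest possible value such that there exist sets of integers $A$ and $B$, with $|A|$ arbitrarily large, satisfying, for some constant $c(K)>0$, both $|A+B|\leq K|A|$ and $|A-B|\geq c(K)\cdot|A+B|^{\theta}$. It is a known result (Gyarmati, Hennecart and Ruzsa) that for every finite set $U$ of non-negative integers containing $0$ one has $\theta\geq 1+\frac{\log(|U-U|/|U+U|)}{\log(2\max(U)+1)}$. -}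

module Defs where

open import Data.Nat as ℕ using (ℕ; _+_; _*_; _^_; _⊔_)
open import Data.Integer as ℤ using (ℤ; +_)
open import Data.List using (List; map; concatMap; length; foldr; deduplicate)

-- A finite set of non-negative integers is represented by a list U : List ℕ
-- (duplicates are harmless: all cardinalities below count distinct elements).

cardℕ : List ℕ → ℕ
cardℕ xs = length (deduplicate ℕ._≟_ xs)

cardℤ : List ℤ → ℕ
cardℤ xs = length (deduplicate ℤ._≟_ xs)

sumset : List ℕ → List ℕ
sumset U = concatMap (λ x → map (λ y → x + y) U) U

diffset : List ℕ → List ℤ
diffset U = concatMap (λ x → map (λ y → (+ x) ℤ.- (+ y)) U) U

maxU : List ℕ → ℕ
maxU U = foldr _⊔_ 0 U

{-# OPTIONS --safe #-}
-- The set is the truncated simplex of all base-11 numerals with M = 2m digits, each digit at most 5, and digit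
-- sum at most L. Its sumset consists of numerals with digits at most 10 and digit sum at most 2L, of which there
-- are at most (1 + t + … + t¹⁰)ᴹ / t²ᴸ for every t ≤ 1. Its difference set contains every vector of signed digits
-- in [−5, 5] whose positive and negative parts both sum to at most L. Weighting such vectors of length m by
-- t^(digit sum of absolute values) and pigeonholing over the pair (positive sum, negative sum) gives a pair (p, q)
-- attained by at least (1 + 2(t + … + t⁵))ᵐ / t^(p + q) vectors, up to a factor polynomial in m; putting such a
-- vector next to the negative of another one makes both sums p + q, so L = p + q works (L = p + q + 1 below,
-- which keeps L positive). The powers of t cancel in the quotient |U−U| / |U+U|, so that the exponent tends to
-- 1 + log((1 + 2(t + … + t⁵)) / (1 + t + … + t¹⁰)) / log 11, which exceeds 1.173050 at t = 5/8.
module Submission where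

open import Defs
open import Data.Nat using (ℕ; _+_; _*_; _^_; _≤_)
open import Data.Product using (Σ; _×_)
open import Data.List using (List)
open import Data.List.Membership.Propositional using (_∈_)

open import Data.Nat using (zero; suc; _∸_; _⊔_; _<_; z≤n; s≤s; s≤s⁻¹; NonZero; >-nonZero; >-nonZero⁻¹; _≟_; _≤?_)
open import Data.Nat.DivMod using (_%_; [m+kn]%n≡m%n; m<n⇒m%n≡m)
open import Data.Nat.ListAction using (sum)
open import Data.Nat.ListAction.Properties using (sum-++)
open import Data.Nat.Properties hiding (_≟_; _≤?_)
open import Data.Nat.Tactic.RingSolver using (solve-∀)
open import Data.Integer as ℤ using (ℤ)
import Data.Integer.Properties as ℤ
import Data.Integer.Tactic.RingSolver as ℤ-Solver
open import Data.Product using (_,_; proj₁; ∃; ∃₂)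
open import Data.Sum using (_⊎_; inj₁; inj₂)
open import Data.List using ([]; _∷_; _++_; map; filter; length; upTo;
  cartesianProduct; cartesianProductWith)
open import Data.List.Properties using (length-map; length-++; map-++; filter-accept;
  filter-reject; foldr-preservesᵇ; foldr-preservesᵒ)
open import Data.List.Membership.Propositional using (find; lose)
open import Data.List.Membership.Propositional.Properties
open import Data.List.Relation.Unary.All as All using (All; []; _∷_)
open import Data.List.Relation.Unary.AllPairs using ([]; _∷_)
open import Data.List.Relation.Unary.Any using (here; there)
open import Data.List.Relation.Unary.Unique.Propositional using (Unique)
import Data.List.Relation.Unary.Unique.Propositional.Properties as Unique
import Data.List.Relation.Unary.Unique.DecPropositional.Properties as DecUnique
open import Data.Vec as Vec using (Vec; []; _∷_; replicate)
import Data.Vec.Properties as Vec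
open import Data.Vec.Relation.Unary.All as VecAll using ([]; _∷_) renaming (All to VecAll)
import Data.Vec.Relation.Unary.All.Properties as VecAll
open import Function using (id; _∘_)
open import Relation.Nullary using (yes; no; contradiction)
open import Relation.Unary using (Decidable)
open import Relation.Binary.PropositionalEquality

private
  variable
    A B : Set
    m k : ℕ

-- Cardinalities

-- Induction on `xs`: one occurrence of `f x` is cut out of `ys`. The remaining images survive the
-- cut, because an image that landed only on the removed entry would equal `f x`, against
-- injectivity and uniqueness. Since `ys` may contain repetitions, this serves for upper and for
-- lower bounds on cardinalities.
length-injection : ∀ (f : A → B) {xs : List A} {ys : List B} → Unique xs →
  (∀ {x} → x ∈ xs → f x ∈ ys) →
  (∀ {x x′} → x ∈ xs → x′ ∈ xs → f x ≡ f x′ → x ≡ x′) →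
  length xs ≤ length ys
length-injection f [] _ _ = z≤n
length-injection f {x ∷ xs} (x∉xs ∷ xs!) into inj with ∈-∃++ (into (here refl))
... | as , bs , refl = begin
  suc (length xs)                   ≤⟨ s≤s (length-injection f xs! into′ (λ p q → inj (there p) (there q))) ⟩
  suc (length (as ++ bs))           ≡⟨ cong suc (length-++ as) ⟩
  suc (length as + length bs)       ≡⟨ +-suc (length as) (length bs) ⟨
  length as + suc (length bs)       ≡⟨ length-++ as ⟨
  length (as ++ f x ∷ bs)           ∎
  where
  open ≤-Reasoning
  into′ : ∀ {x′} → x′ ∈ xs → f x′ ∈ as ++ bs
  into′ {x′} x′∈ with ∈-++⁻ as (into (there x′∈))
  ... | inj₁ p          = ∈-++⁺ˡ p
  ... | inj₂ (here eq)  = contradiction (inj (here refl) (there x′∈) (sym eq)) (All.lookup x∉xs x′∈)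
  ... | inj₂ (there p)  = ∈-++⁺ʳ as p

cardℕ≤length : ∀ {xs ys : List ℕ} → (∀ {x} → x ∈ xs → x ∈ ys) → cardℕ xs ≤ length ys
cardℕ≤length {xs} xs⊆ys = length-injection id (DecUnique.deduplicate-! _≟_ xs)
  (xs⊆ys ∘ ∈-deduplicate⁻ _≟_ xs) (λ _ _ eq → eq)

length≤cardℤ : ∀ (f : A → ℤ) {xs : List A} {ys : List ℤ} → Unique xs →
  (∀ {x} → x ∈ xs → f x ∈ ys) →
  (∀ {x x′} → x ∈ xs → x′ ∈ xs → f x ≡ f x′ → x ≡ x′) →
  length xs ≤ cardℤ ys
length≤cardℤ f xs! into inj = length-injection f xs! (∈-deduplicate⁺ ℤ._≟_ ∘ into) inj

∈-sumset⁻ : ∀ {U z} → z ∈ sumset U → ∃₂ λ x y → x ∈ U × y ∈ U × z ≡ x + y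
∈-sumset⁻ {U} z∈ with find (∈-concatMap⁻ (λ x → map (x +_) U) {U} z∈)
... | x , x∈ , z∈′ with ∈-map⁻ (x +_) z∈′
... | y , y∈ , eq = x , y , x∈ , y∈ , eq

∈-diffset⁺ : ∀ {U x y} → x ∈ U → y ∈ U → ℤ.+ x ℤ.- ℤ.+ y ∈ diffset U
∈-diffset⁺ {U} {x} x∈ y∈ = ∈-concatMap⁺ (λ x → map (λ y → ℤ.+ x ℤ.- ℤ.+ y) U)
  (lose x∈ (∈-map⁺ (λ y → ℤ.+ x ℤ.- ℤ.+ y) y∈))

-- Sums over lists

-- Here and in `length-*-≤` the number `b` acts as a denominator: comparisons of `g x` with the
-- fraction c / b are kept inside ℕ.
sum-*ʳ-≤ : ∀ (g : A → ℕ) b c (xs : List A) → (∀ {x} → x ∈ xs → g x * b ≤ c) →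
  sum (map g xs) * b ≤ length xs * c
sum-*ʳ-≤ g b c []       _ = z≤n
sum-*ʳ-≤ g b c (x ∷ xs) h = begin
  (g x + sum (map g xs)) * b      ≡⟨ *-distribʳ-+ b (g x) _ ⟩
  g x * b + sum (map g xs) * b    ≤⟨ +-mono-≤ (h (here refl)) (sum-*ʳ-≤ g b c xs (h ∘ there)) ⟩
  c + length xs * c               ∎
  where open ≤-Reasoning

length-*-≤ : ∀ (g : A → ℕ) b c (xs : List A) → (∀ {x} → x ∈ xs → c ≤ g x * b) →
  length xs * c ≤ sum (map g xs) * b
length-*-≤ g b c []       _ = z≤n
length-*-≤ g b c (x ∷ xs) h = begin
  c + length xs * c               ≤⟨ +-mono-≤ (h (here refl)) (length-*-≤ g b c xs (h ∘ there)) ⟩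
  g x * b + sum (map g xs) * b    ≡⟨ *-distribʳ-+ b (g x) _ ⟨
  (g x + sum (map g xs)) * b      ∎
  where open ≤-Reasoning

sum-filter-≤ : ∀ (g : A → ℕ) {P : A → Set} (P? : Decidable P) xs →
  sum (map g (filter P? xs)) ≤ sum (map g xs)
sum-filter-≤ g P? []       = z≤n
sum-filter-≤ g P? (x ∷ xs) with P? x
... | yes _ = +-monoʳ-≤ (g x) (sum-filter-≤ g P? xs)
... | no  _ = m≤n⇒m≤o+n (g x) (sum-filter-≤ g P? xs)

sumBelow : ℕ → (ℕ → ℕ) → ℕ
sumBelow zero    F = 0
sumBelow (suc n) F = sumBelow n F + F n

sumBelow-mono : ∀ n {F G} → (∀ i → F i ≤ G i) → sumBelow n F ≤ sumBelow n G
sumBelow-mono zero    F≤G = z≤n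
sumBelow-mono (suc n) F≤G = +-mono-≤ (sumBelow-mono n F≤G) (F≤G n)

-- The induction step of the partition count in `pigeonhole`: a new element raises the weight of its
-- own class `i` and lowers no other.
sumBelow-bump : ∀ n c i {F G} → i < n → (∀ i → F i ≤ G i) → c + F i ≤ G i →
  c + sumBelow n F ≤ sumBelow n G
sumBelow-bump (suc n) c i {F} {G} i<1+n F≤G bump with i ≟ n
... | yes refl = begin
  c + (sumBelow n F + F n)    ≡⟨ cong (_+_ c) (+-comm (sumBelow n F) (F n)) ⟩
  c + (F n + sumBelow n F)    ≡⟨ +-assoc c (F n) _ ⟨
  c + F n + sumBelow n F      ≤⟨ +-mono-≤ bump (sumBelow-mono n F≤G) ⟩
  G n + sumBelow n G          ≡⟨ +-comm (G n) _ ⟩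
  sumBelow n G + G n          ∎
  where open ≤-Reasoning
... | no i≢n = begin
  c + (sumBelow n F + F n)    ≡⟨ +-assoc c _ (F n) ⟨
  c + sumBelow n F + F n      ≤⟨ +-mono-≤ (sumBelow-bump n c i (≤∧≢⇒< (s≤s⁻¹ i<1+n) i≢n) F≤G bump) (F≤G n) ⟩
  sumBelow n G + G n          ∎
  where open ≤-Reasoning

sumBelow≤n*max : ∀ n F → ∃ λ j → sumBelow (suc n) F ≤ suc n * F j
sumBelow≤n*max zero    F = 0 , ≤-reflexive (sym (*-identityˡ (F 0)))
sumBelow≤n*max (suc n) F with sumBelow≤n*max n F
... | j , ih with ≤-total (F j) (F (suc n))
... | inj₁ le = suc n , (begin
  sumBelow (suc n) F + F (suc n)        ≤⟨ +-monoˡ-≤ (F (suc n)) (≤-trans ih (*-monoʳ-≤ (suc n) le)) ⟩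
  suc n * F (suc n) + F (suc n)         ≡⟨ +-comm _ (F (suc n)) ⟩
  suc (suc n) * F (suc n)               ∎)
  where open ≤-Reasoning
... | inj₂ ge = j , (begin
  sumBelow (suc n) F + F (suc n)        ≤⟨ +-mono-≤ ih ge ⟩
  suc n * F j + F j                     ≡⟨ +-comm _ (F j) ⟩
  suc (suc n) * F j                     ∎)
  where open ≤-Reasoning

-- The classes with index at most `n` exhaust the list, so their weights add up to at least the
-- whole, and the heaviest of the `suc n` classes will do.
pigeonhole : ∀ (g k : A → ℕ) n xs → (∀ {x} → x ∈ xs → k x ≤ n) →
  ∃ λ j → sum (map g xs) ≤ suc n * sum (map g (filter (λ x → k x ≟ j) xs))
pigeonhole {A} g k n xs k≤n with sumBelow≤n*max n (λ j → sum (map g (filter (λ x → k x ≟ j) xs)))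
... | j , le = j , ≤-trans (split xs k≤n) le
  where
  class : List A → ℕ → ℕ
  class xs j = sum (map g (filter (λ x → k x ≟ j) xs))

  class-mono : ∀ x xs i → class xs i ≤ class (x ∷ xs) i
  class-mono x xs i with k x ≟ i
  ... | yes p rewrite filter-accept (λ x → k x ≟ i) {x} {xs} p = m≤n+m _ (g x)
  ... | no ¬p rewrite filter-reject (λ x → k x ≟ i) {x} {xs} ¬p = ≤-refl

  split : ∀ xs → (∀ {x} → x ∈ xs → k x ≤ n) → sum (map g xs) ≤ sumBelow (suc n) (class xs)
  split []       _   = z≤n
  split (x ∷ xs) k≤n = ≤-trans (+-monoʳ-≤ (g x) (split xs (k≤n ∘ there)))
    (sumBelow-bump (suc n) (g x) (k x) (s≤s (k≤n (here refl))) (class-mono x xs)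
      (≤-reflexive (sym (cong (sum ∘ map g) (filter-accept (λ y → k y ≟ k x) {x} {xs} refl)))))

-- Words over the alphabet {0, …, n − 1}

words : ∀ n m → List (Vec ℕ m)
words n zero    = [] ∷ []
words n (suc m) = cartesianProductWith _∷_ (upTo n) (words n m)

∈-words⁺ : ∀ {v : Vec ℕ m} → VecAll (_< k) v → v ∈ words k m
∈-words⁺ []       = here refl
∈-words⁺ (p ∷ ps) = ∈-cartesianProductWith⁺ _∷_ (∈-upTo⁺ p) (∈-words⁺ ps)

∈-words⁻ : ∀ (v : Vec ℕ m) → v ∈ words k m → VecAll (_< k) v
∈-words⁻ []      _ = []
∈-words⁻ {suc m} {k} (d ∷ v) p with ∈-cartesianProductWith⁻ _∷_ (upTo k) (words k m) p
... | _ , _ , q , r , refl = ∈-upTo⁻ q ∷ ∈-words⁻ v r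

words-unique : ∀ n m → Unique (words n m)
words-unique n zero    = [] ∷ []
words-unique n (suc m) = Unique.cartesianProductWith⁺ _∷_ Vec.∷-injective (Unique.upTo⁺ n) (words-unique n m)

total : (ℕ → ℕ) → Vec ℕ m → ℕ
total f v = Vec.sum (Vec.map f v)

total-≤ : ∀ f c {v : Vec ℕ m} → VecAll (λ d → f d ≤ c) v → total f v ≤ m * c
total-≤ f c []       = z≤n
total-≤ f c (p ∷ ps) = +-mono-≤ p (total-≤ f c ps)

∏ : (ℕ → ℕ) → Vec ℕ m → ℕ
∏ w []      = 1
∏ w (d ∷ v) = w d * ∏ w v

-- Expanding the `m`-th power of the one-letter generating function produces one product for each
-- word.
sum-∏ : ∀ w n m → sum (map (∏ w) (words n m)) ≡ sum (map w (upTo n)) ^ m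
sum-∏ w n zero    = refl
sum-∏ w n (suc m) = trans (distrib (upTo n)) (cong (sum (map w (upTo n)) *_) (sum-∏ w n m))
  where
  open ≡-Reasoning
  scale : ∀ d (vs : List (Vec ℕ m)) → sum (map (∏ w) (map (d ∷_) vs)) ≡ w d * sum (map (∏ w) vs)
  scale d []       = sym (*-zeroʳ (w d))
  scale d (v ∷ vs) = trans (cong (_+_ (w d * ∏ w v)) (scale d vs)) (sym (*-distribˡ-+ (w d) _ _))
  distrib : ∀ ds → sum (map (∏ w) (cartesianProductWith _∷_ ds (words n m)))
                 ≡ sum (map w ds) * sum (map (∏ w) (words n m))
  distrib []       = refl
  distrib (d ∷ ds) = begin
    sum (map (∏ w) (map (d ∷_) (words n m) ++ rest))
      ≡⟨ cong sum (map-++ (∏ w) (map (d ∷_) (words n m)) rest) ⟩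
    sum (map (∏ w) (map (d ∷_) (words n m)) ++ map (∏ w) rest)
      ≡⟨ sum-++ (map (∏ w) (map (d ∷_) (words n m))) _ ⟩
    sum (map (∏ w) (map (d ∷_) (words n m))) + sum (map (∏ w) rest)
      ≡⟨ cong₂ _+_ (scale d (words n m)) (distrib ds) ⟩
    w d * total-words + sum (map w ds) * total-words
      ≡⟨ *-distribʳ-+ total-words (w d) _ ⟨
    (w d + sum (map w ds)) * total-words
      ∎
    where
    rest = cartesianProductWith _∷_ ds (words n m)
    total-words = sum (map (∏ w) (words n m))

-- (a / b) ^ f d, scaled by b ^ c
weight : (a b c : ℕ) → (ℕ → ℕ) → ℕ → ℕ
weight a b c f d = a ^ f d * b ^ (c ∸ f d)

weight-scale : ∀ a b c f d → f d ≤ c → weight a b c f d * b ^ f d ≡ a ^ f d * b ^ c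
weight-scale a b c f d fd≤c = begin
  a ^ f d * b ^ (c ∸ f d) * b ^ f d    ≡⟨ *-assoc (a ^ f d) _ _ ⟩
  a ^ f d * (b ^ (c ∸ f d) * b ^ f d)  ≡⟨ cong (a ^ f d *_) (^-distribˡ-+-* b (c ∸ f d) (f d)) ⟨
  a ^ f d * b ^ (c ∸ f d + f d)        ≡⟨ cong (λ e → a ^ f d * b ^ e) (m∸n+n≡m fd≤c) ⟩
  a ^ f d * b ^ c                      ∎
  where open ≡-Reasoning

-- With t = a / b, the weight of a word is t to the power of its total, up to the common scale
-- `(b ^ c) ^ m`; the factor `b ^ total f v` clears the denominator. Words with equal totals thus
-- weigh the same.
∏-weight : ∀ a b c f {v : Vec ℕ m} → VecAll (λ d → f d ≤ c) v →
  ∏ (weight a b c f) v * b ^ total f v ≡ a ^ total f v * (b ^ c) ^ m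
∏-weight a b c f [] = refl
∏-weight {suc m} a b c f {d ∷ v} (p ∷ ps) = begin
  w * ∏ (weight a b c f) v * b ^ (f d + total f v)
    ≡⟨ cong (w * ∏ (weight a b c f) v *_) (^-distribˡ-+-* b (f d) (total f v)) ⟩
  w * ∏ (weight a b c f) v * (b ^ f d * b ^ total f v)
    ≡⟨ [m*n]*[o*p]≡[m*o]*[n*p] w _ (b ^ f d) _ ⟩
  w * b ^ f d * (∏ (weight a b c f) v * b ^ total f v)
    ≡⟨ cong₂ _*_ (weight-scale a b c f d p) (∏-weight a b c f ps) ⟩
  a ^ f d * b ^ c * (a ^ total f v * (b ^ c) ^ m)
    ≡⟨ [m*n]*[o*p]≡[m*o]*[n*p] (a ^ f d) _ (a ^ total f v) _ ⟩
  a ^ f d * a ^ total f v * (b ^ c) ^ suc m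
    ≡⟨ cong (_* (b ^ c) ^ suc m) (^-distribˡ-+-* a (f d) (total f v)) ⟨
  a ^ (f d + total f v) * (b ^ c) ^ suc m
    ∎
  where
  open ≡-Reasoning
  w = weight a b c f d

-- Values of words in base n

val : ℕ → Vec ℕ m → ℕ
val n []      = 0
val n (d ∷ v) = d + val n v * n

val-++ : ∀ n (u : Vec ℕ m) {l} (v : Vec ℕ l) → val n (u Vec.++ v) ≡ val n u + n ^ m * val n v
val-++ n []      v = sym (+-identityʳ _)
val-++ {suc m} n (d ∷ u) v rewrite val-++ n u v = eq d (val n u) (n ^ m) (val n v) n
  where
  eq : ∀ d x p y n → d + (x + p * y) * n ≡ d + x * n + n * p * y
  eq = solve-∀

val-zipWith-+ : ∀ n (u v : Vec ℕ m) → val n (Vec.zipWith _+_ u v) ≡ val n u + val n v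
val-zipWith-+ n []      []      = refl
val-zipWith-+ n (d ∷ u) (e ∷ v) rewrite val-zipWith-+ n u v = eq d e (val n u) (val n v) n
  where
  eq : ∀ d e x y n → d + e + (x + y) * n ≡ d + x * n + (e + y * n)
  eq = solve-∀

sum-zipWith-+ : ∀ (u v : Vec ℕ m) → Vec.sum (Vec.zipWith _+_ u v) ≡ Vec.sum u + Vec.sum v
sum-zipWith-+ []      []      = refl
sum-zipWith-+ (d ∷ u) (e ∷ v) rewrite sum-zipWith-+ u v = eq d e (Vec.sum u) (Vec.sum v)
  where
  eq : ∀ d e x y → d + e + (x + y) ≡ d + x + (e + y)
  eq = solve-∀

val-replicate-0 : ∀ n m → val n (replicate m 0) ≡ 0
val-replicate-0 n zero    = refl
val-replicate-0 n (suc m) rewrite val-replicate-0 n m = refl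

sum-replicate-0 : ∀ m → Vec.sum (replicate m 0) ≡ 0
sum-replicate-0 zero    = refl
sum-replicate-0 (suc m) = sum-replicate-0 m

all-replicate-0 : ∀ {P : ℕ → Set} m → P 0 → VecAll P (replicate m 0)
all-replicate-0 zero    p = []
all-replicate-0 (suc m) p = p ∷ all-replicate-0 m p

-- The lowest digit is the remainder modulo `n`; cancelling it and dividing by `n` leaves the tails.
val-injective : ∀ n .{{_ : NonZero n}} {u v : Vec ℕ m} → VecAll (_< n) u → VecAll (_< n) v →
  val n u ≡ val n v → u ≡ v
val-injective n []                 []                 _  = refl
val-injective n {d ∷ u} {e ∷ v} (p ∷ ps) (q ∷ qs) eq = cong₂ _∷_ d≡e (val-injective n ps qs tails)
  where
  open ≡-Reasoning
  d≡e : d ≡ e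
  d≡e = begin
    d                      ≡⟨ m<n⇒m%n≡m p ⟨
    d % n                  ≡⟨ [m+kn]%n≡m%n d (val n u) n ⟨
    (d + val n u * n) % n  ≡⟨ cong (_% n) eq ⟩
    (e + val n v * n) % n  ≡⟨ [m+kn]%n≡m%n e (val n v) n ⟩
    e % n                  ≡⟨ m<n⇒m%n≡m q ⟩
    e                      ∎
  tails : val n u ≡ val n v
  tails = *-cancelʳ-≡ _ _ n (+-cancelˡ-≡ d _ _ (trans eq (cong (_+ val n v * n) (sym d≡e))))

-- Signed digits: d ∈ {0, …, 2h} stands for d − h = (d ∸ h) − (h ∸ d)

-- In base 2h + 1 two digits at most `h` add without a carry, and shifted signed digits are again
-- ordinary digits.
base : ℕ → ℕ
base h = suc (h + h)

∸-balance : ∀ h d → d ∸ h + h ≡ h ∸ d + d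
∸-balance zero    d       = trans (+-identityʳ d) (cong (_+ d) (sym (0∸n≡0 d)))
∸-balance (suc h) zero    = sym (+-identityʳ (suc h))
∸-balance (suc h) (suc d) = trans (+-suc (d ∸ h) h) (trans (cong suc (∸-balance h d)) (sym (+-suc (h ∸ d) d)))

pos neg : ℕ → Vec ℕ m → Vec ℕ m
pos h = Vec.map (_∸ h)
neg h = Vec.map (h ∸_)

-- Reading each digit d as d - h lowers the value of a word by the value of the constant word h...h;
-- moving terms across avoids subtraction.
val-balance : ∀ n h (v : Vec ℕ m) → val n (pos h v) + val n (replicate m h) ≡ val n (neg h v) + val n v
val-balance n h []      = refl
val-balance {suc m} n h (d ∷ v) = begin
  d ∸ h + P * n + (h + H * n)     ≡⟨ eq (d ∸ h) P h H n ⟩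
  d ∸ h + h + (P + H) * n         ≡⟨ cong₂ (λ x y → x + y * n) (∸-balance h d) (val-balance n h v) ⟩
  h ∸ d + d + (N + val n v) * n   ≡⟨ eq (h ∸ d) N d (val n v) n ⟨
  h ∸ d + N * n + (d + val n v * n) ∎
  where
  open ≡-Reasoning
  P = val n (pos h v)
  N = val n (neg h v)
  H = val n (replicate m h)
  eq : ∀ x p y q n → x + p * n + (y + q * n) ≡ x + y + (p + q) * n
  eq = solve-∀

digit∸h≤h : ∀ h {d} → d < base h → d ∸ h ≤ h
digit∸h≤h h {d} d<n = ≤-trans (∸-monoˡ-≤ h (s≤s⁻¹ d<n)) (≤-reflexive (m+n∸n≡m h h))

∣digit∣≤h : ∀ h {d} → d < base h → (d ∸ h) + (h ∸ d) ≤ h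
∣digit∣≤h h {d} d<n with ≤-total d h
... | inj₁ d≤h rewrite m≤n⇒m∸n≡0 d≤h = m∸n≤m h d
... | inj₂ h≤d rewrite m≤n⇒m∸n≡0 h≤d = ≤-trans (≤-reflexive (+-identityʳ (d ∸ h))) (digit∸h≤h h d<n)

total-+ : ∀ f g (v : Vec ℕ m) → total (λ d → f d + g d) v ≡ total f v + total g v
total-+ f g []      = refl
total-+ f g (d ∷ v) = trans (cong (f d + g d +_) (total-+ f g v)) (eq (f d) (g d) (total f v) (total g v))
  where
  eq : ∀ x y s t → x + y + (s + t) ≡ x + s + (y + t)
  eq = solve-∀

-- The truncated simplex in dimension M, read in base 2h + 1

simplex : (h M L : ℕ) → List ℕ
simplex h M L = map (val (base h)) (filter (λ v → Vec.sum v ≤? L) (words (suc h) M))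

∈-simplex⁺ : ∀ h L {v : Vec ℕ m} → VecAll (_≤ h) v → Vec.sum v ≤ L → val (base h) v ∈ simplex h m L
∈-simplex⁺ h L v≤h sum≤L = ∈-map⁺ (val (base h)) (∈-filter⁺ (λ v → Vec.sum v ≤? L) (∈-words⁺ (VecAll.map s≤s v≤h)) sum≤L)

∈-simplex⁻ : ∀ h M L {x} → x ∈ simplex h M L →
  ∃ λ (v : Vec ℕ M) → VecAll (_≤ h) v × Vec.sum v ≤ L × x ≡ val (base h) v
∈-simplex⁻ h M L x∈ with ∈-map⁻ (val (base h)) x∈
... | v , v∈ , x≡ with ∈-filter⁻ (λ v → Vec.sum v ≤? L) {xs = words (suc h) M} v∈
... | v∈words , sum≤L = v , VecAll.map s≤s⁻¹ (∈-words⁻ v v∈words) , sum≤L , x≡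

0∈simplex : ∀ h M L → 0 ∈ simplex h M L
0∈simplex h M L = subst (_∈ simplex h M L) (val-replicate-0 (base h) M)
  (∈-simplex⁺ h L (all-replicate-0 M z≤n) (≤-trans (≤-reflexive (sum-replicate-0 M)) z≤n))

1≤maxU-simplex : ∀ h M L .{{_ : NonZero M}} → 1 ≤ h → 1 ≤ L → 1 ≤ maxU (simplex h M L)
1≤maxU-simplex h (suc M) L 1≤h 1≤L = foldr-preservesᵒ larger 0 (simplex h (suc M) L)
  (inj₂ (lose 1∈ ≤-refl))
  where
  larger : ∀ x y → 1 ≤ x ⊎ 1 ≤ y → 1 ≤ x ⊔ y
  larger x y (inj₁ p) = m≤n⇒m≤n⊔o y p
  larger x y (inj₂ p) = m≤n⇒m≤o⊔n x p
  value : val (base h) (1 ∷ replicate M 0) ≡ 1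
  value rewrite val-replicate-0 (base h) M = refl
  1∈ : 1 ∈ simplex h (suc M) L
  1∈ = subst (_∈ simplex h (suc M) L) value
    (∈-simplex⁺ h L (1≤h ∷ all-replicate-0 M z≤n) (subst (λ s → suc s ≤ L) (sym (sum-replicate-0 M)) 1≤L))

-- The extreme case is the constant word h...h, whose value is (n^m - 1) / 2 for n = 2h + 1, so the
-- bound is sharp.
2*val+1≤ : ∀ h {v : Vec ℕ m} → VecAll (_≤ h) v → 2 * val (base h) v + 1 ≤ base h ^ m
2*val+1≤ h [] = ≤-refl
2*val+1≤ {suc m} h {d ∷ v} (p ∷ ps) = begin
  2 * (d + x * n) + 1          ≡⟨ eq₁ d (x * n) ⟩
  suc (d + d) + 2 * (x * n)    ≤⟨ +-monoˡ-≤ _ (s≤s (+-mono-≤ p p)) ⟩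
  n + 2 * (x * n)              ≡⟨ eq₂ n x ⟩
  n * (2 * x + 1)              ≤⟨ *-monoʳ-≤ n (2*val+1≤ h ps) ⟩
  n * n ^ m                    ∎
  where
  open ≤-Reasoning
  n = base h
  x = val n v
  eq₁ : ∀ d y → 2 * (d + y) + 1 ≡ suc (d + d) + 2 * y
  eq₁ = solve-∀
  eq₂ : ∀ n x → n + 2 * (x * n) ≡ n * (2 * x + 1)
  eq₂ = solve-∀

2*maxU-simplex+1≤ : ∀ h M L → 2 * maxU (simplex h M L) + 1 ≤ base h ^ M
2*maxU-simplex+1≤ h M L = foldr-preservesᵇ {P = λ x → 2 * x + 1 ≤ base h ^ M} (λ {x} {y} → ⊔-closed {x} {y})
  -- The fold starts at the default value 0, for which the bound reads `1 ≤ base h ^ M`.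
  (m^n>0 (base h) M) (All.tabulate bound)
  where
  ⊔-closed : ∀ {x y} → 2 * x + 1 ≤ base h ^ M → 2 * y + 1 ≤ base h ^ M → 2 * (x ⊔ y) + 1 ≤ base h ^ M
  ⊔-closed {x} {y} p q with ⊔-sel x y
  ... | inj₁ eq rewrite eq = p
  ... | inj₂ eq rewrite eq = q
  bound : ∀ {x} → x ∈ simplex h M L → 2 * x + 1 ≤ base h ^ M
  bound x∈ with ∈-simplex⁻ h M L x∈
  ... | v , v≤h , _ , refl = 2*val+1≤ h v≤h

-- The sumset

sumset-simplex⊆ : ∀ h M L {z} → z ∈ sumset (simplex h M L) →
  z ∈ map (val (base h)) (filter (λ v → total id v ≤? L + L) (words (base h) M))
sumset-simplex⊆ h M L z∈ with ∈-sumset⁻ {simplex h M L} z∈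
... | _ , _ , x∈ , y∈ , refl with ∈-simplex⁻ h M L x∈ | ∈-simplex⁻ h M L y∈
... | u , u≤h , u≤L , refl | v , v≤h , v≤L , refl =
  subst (_∈ map (val (base h)) _) (val-zipWith-+ (base h) u v)
    (∈-map⁺ (val (base h)) (∈-filter⁺ (λ v → total id v ≤? L + L) (∈-words⁺ (digits u≤h v≤h)) total≤))
  where
  open ≤-Reasoning
  digits : ∀ {m} {u v : Vec ℕ m} → VecAll (_≤ h) u → VecAll (_≤ h) v → VecAll (_< base h) (Vec.zipWith _+_ u v)
  digits []       []       = []
  digits (p ∷ ps) (q ∷ qs) = s≤s (+-mono-≤ p q) ∷ digits ps qs
  total≤ : total id (Vec.zipWith _+_ u v) ≤ L + L
  total≤ = begin
    total id (Vec.zipWith _+_ u v)   ≡⟨ cong Vec.sum (Vec.map-id (Vec.zipWith _+_ u v)) ⟩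
    Vec.sum (Vec.zipWith _+_ u v)    ≡⟨ sum-zipWith-+ u v ⟩
    Vec.sum u + Vec.sum v            ≤⟨ +-mono-≤ u≤L v≤L ⟩
    L + L                            ∎

-- A Chernoff-type bound: since t = a / b ≤ 1, each word with digit sum at most 2L weighs at least
-- t^(2L), up to scale, while all words together weigh the `M`-th power of a one-letter sum.
sumset-simplex-≤ : ∀ h M L a b → a ≤ b →
  cardℕ (sumset (simplex h M L)) * (a ^ (L + L) * (b ^ (h + h)) ^ M)
    ≤ sum (map (weight a b (h + h) id) (upTo (base h))) ^ M * b ^ (L + L)
sumset-simplex-≤ h M L a b a≤b = begin
  cardℕ (sumset (simplex h M L)) * C
    ≤⟨ *-monoˡ-≤ C (cardℕ≤length (sumset-simplex⊆ h M L)) ⟩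
  length (map (val (base h)) V) * C
    ≡⟨ cong (_* C) (length-map (val (base h)) V) ⟩
  length V * C
    ≤⟨ length-*-≤ (∏ w) (b ^ (L + L)) C V term ⟩
  sum (map (∏ w) V) * b ^ (L + L)
    ≤⟨ *-monoˡ-≤ (b ^ (L + L)) (sum-filter-≤ (∏ w) (λ v → total id v ≤? L + L) (words (base h) M)) ⟩
  sum (map (∏ w) (words (base h) M)) * b ^ (L + L)
    ≡⟨ cong (_* b ^ (L + L)) (sum-∏ w (base h) M) ⟩
  sum (map w (upTo (base h))) ^ M * b ^ (L + L)
    ∎
  where
  open ≤-Reasoning
  w = weight a b (h + h) id
  G = (b ^ (h + h)) ^ M
  C = a ^ (L + L) * G
  V = filter (λ v → total id v ≤? L + L) (words (base h) M)
  ^-split : ∀ x {s t} → s ≤ t → x ^ t ≡ x ^ s * x ^ (t ∸ s)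
  ^-split x {s} {t} s≤t = trans (cong (x ^_) (sym (m+[n∸m]≡n s≤t))) (^-distribˡ-+-* x s (t ∸ s))
  term : ∀ {v} → v ∈ V → C ≤ ∏ w v * b ^ (L + L)
  term {v} v∈ with ∈-filter⁻ (λ v → total id v ≤? L + L) {xs = words (base h) M} v∈
  ... | v∈words , s≤2L = begin
    a ^ (L + L) * G                    ≡⟨ cong (_* G) (^-split a s≤2L) ⟩
    a ^ s * a ^ r * G                  ≡⟨ eq₁ (a ^ s) (a ^ r) G ⟩
    a ^ s * G * a ^ r                  ≡⟨ cong (_* a ^ r) (∏-weight a b (h + h) id (VecAll.map s≤s⁻¹ (∈-words⁻ v v∈words))) ⟨
    -- This is t^(2L - s) ≤ 1 without fractions.
    ∏ w v * b ^ s * a ^ r              ≤⟨ *-monoʳ-≤ (∏ w v * b ^ s) (^-monoˡ-≤ r a≤b) ⟩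
    ∏ w v * b ^ s * b ^ r              ≡⟨ *-assoc (∏ w v) _ _ ⟩
    ∏ w v * (b ^ s * b ^ r)            ≡⟨ cong (∏ w v *_) (^-split b s≤2L) ⟨
    ∏ w v * b ^ (L + L)                ∎
    where
    s = total id v
    r = L + L ∸ s
    eq₁ : ∀ x y z → x * y * z ≡ x * z * y
    eq₁ = solve-∀

-- The difference set

-- The second pigeonhole, on the negative sum, runs inside the class chosen by the first; each costs
-- a factor `suc (m * h)`. All words in the final class have the same weight, t^(p + q) up to scale,
-- so a bound on their total weight is a bound on their number.
popular-class : ∀ h m a b → ∃₂ λ p q → ∃ λ (X : List (Vec ℕ m)) → Unique X ×
  (∀ {v} → v ∈ X → VecAll (_< base h) v × Vec.sum (pos h v) ≡ p × Vec.sum (neg h v) ≡ q) ×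
  sum (map (weight a b h (λ d → (d ∸ h) + (h ∸ d))) (upTo (base h))) ^ m * b ^ (p + q)
    ≤ suc (m * h) * suc (m * h) * (length X * (a ^ (p + q) * (b ^ h) ^ m))
popular-class h m a b
  with pigeonhole (∏ (weight a b h (λ d → (d ∸ h) + (h ∸ d)))) (total (_∸ h)) (m * h) (words (base h) m)
         (λ {v} v∈ → total-≤ (_∸ h) h (VecAll.map (digit∸h≤h h) (∈-words⁻ v v∈)))
... | p , p-popular
  with pigeonhole (∏ (weight a b h (λ d → (d ∸ h) + (h ∸ d)))) (total (h ∸_)) (m * h)
         (filter (λ v → total (_∸ h) v ≟ p) (words (base h) m))
         (λ {v} v∈ → total-≤ (h ∸_) h (VecAll.map (λ {d} _ → m∸n≤m h d)
           (∈-words⁻ v (proj₁ (∈-filter⁻ (λ v → total (_∸ h) v ≟ p) {xs = words (base h) m} v∈)))))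
... | q , q-popular = p , q , X , X! , X-spec , bound
  where
  open ≤-Reasoning
  f : ℕ → ℕ
  f d = (d ∸ h) + (h ∸ d)
  w = weight a b h f
  K = suc (m * h)
  Y X : List (Vec ℕ m)
  Y = filter (λ v → total (_∸ h) v ≟ p) (words (base h) m)
  X = filter (λ v → total (h ∸_) v ≟ q) Y
  X! : Unique X
  X! = Unique.filter⁺ (λ v → total (h ∸_) v ≟ q) (Unique.filter⁺ (λ v → total (_∸ h) v ≟ p) (words-unique (base h) m))
  X-spec : ∀ {v} → v ∈ X → VecAll (_< base h) v × total (_∸ h) v ≡ p × total (h ∸_) v ≡ q
  X-spec {v} v∈ with ∈-filter⁻ (λ v → total (h ∸_) v ≟ q) {xs = Y} v∈
  ... | v∈Y , eq with ∈-filter⁻ (λ v → total (_∸ h) v ≟ p) {xs = words (base h) m} v∈Y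
  ... | v∈words , eq′ = ∈-words⁻ v v∈words , eq′ , eq
  term : ∀ {v} → v ∈ X → ∏ w v * b ^ (p + q) ≤ a ^ (p + q) * (b ^ h) ^ m
  term {v} v∈ with X-spec v∈
  -- The two sums merge into the sum of the absolute values |d - h|, which is the exponent in the
  -- weight of `v`.
  ... | v<n , refl , refl rewrite sym (total-+ (_∸ h) (h ∸_) v) =
    ≤-reflexive (∏-weight a b h f (VecAll.map (∣digit∣≤h h) v<n))
  eq : ∀ K S B → K * (K * S) * B ≡ K * K * (S * B)
  eq = solve-∀
  bound : sum (map w (upTo (base h))) ^ m * b ^ (p + q) ≤ K * K * (length X * (a ^ (p + q) * (b ^ h) ^ m))
  bound = begin
    sum (map w (upTo (base h))) ^ m * b ^ (p + q)
      ≡⟨ cong (_* b ^ (p + q)) (sum-∏ w (base h) m) ⟨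
    sum (map (∏ w) (words (base h) m)) * b ^ (p + q)
      ≤⟨ *-monoˡ-≤ (b ^ (p + q)) (≤-trans p-popular (*-monoʳ-≤ K q-popular)) ⟩
    K * (K * sum (map (∏ w) X)) * b ^ (p + q)
      ≡⟨ eq K (sum (map (∏ w) X)) (b ^ (p + q)) ⟩
    K * K * (sum (map (∏ w) X) * b ^ (p + q))
      ≤⟨ *-monoʳ-≤ (K * K) (sum-*ʳ-≤ (∏ w) (b ^ (p + q)) _ X term) ⟩
    K * K * (length X * (a ^ (p + q) * (b ^ h) ^ m))
      ∎

length-cartesianProduct : ∀ (xs : List A) (ys : List B) → length (cartesianProduct xs ys) ≡ length xs * length ys
length-cartesianProduct []       ys = refl
length-cartesianProduct (x ∷ xs) ys = trans (length-++ (map (x ,_) ys))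
  (cong₂ _+_ (length-map (x ,_) ys) (length-cartesianProduct xs ys))

-‿cross : ∀ x y x′ y′ → ℤ.+ x ℤ.- ℤ.+ y ≡ ℤ.+ x′ ℤ.- ℤ.+ y′ → x + y′ ≡ x′ + y
-‿cross x y x′ y′ eq = ℤ.+-injective (begin
  ℤ.+ x ℤ.+ ℤ.+ y′                                 ≡⟨ eq₁ (ℤ.+ x) (ℤ.+ y) (ℤ.+ y′) ⟩
  (ℤ.+ x ℤ.- ℤ.+ y) ℤ.+ (ℤ.+ y ℤ.+ ℤ.+ y′)         ≡⟨ cong (ℤ._+ (ℤ.+ y ℤ.+ ℤ.+ y′)) eq ⟩
  (ℤ.+ x′ ℤ.- ℤ.+ y′) ℤ.+ (ℤ.+ y ℤ.+ ℤ.+ y′)       ≡⟨ eq₂ (ℤ.+ x′) (ℤ.+ y) (ℤ.+ y′) ⟩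
  ℤ.+ x′ ℤ.+ ℤ.+ y                                 ∎)
  where
  open ≡-Reasoning
  eq₁ : ∀ x y z → x ℤ.+ z ≡ (x ℤ.- y) ℤ.+ (y ℤ.+ z)
  eq₁ = ℤ-Solver.solve-∀
  eq₂ : ∀ x y z → (x ℤ.- z) ℤ.+ (y ℤ.+ z) ≡ x ℤ.+ y
  eq₂ = ℤ-Solver.solve-∀

-- u and the negative of v, side by side: the positive part and the negative part both sum to p + q.
diffset-simplex-≥ : ∀ h L p q (X : List (Vec ℕ m)) → Unique X →
  (∀ {v} → v ∈ X → VecAll (_< base h) v × Vec.sum (pos h v) ≡ p × Vec.sum (neg h v) ≡ q) →
  p + q ≤ L → length X * length X ≤ cardℤ (diffset (simplex h (m + m) L))
diffset-simplex-≥ {m} h L p q X X! spec p+q≤L =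
  subst (_≤ cardℤ (diffset (simplex h (m + m) L))) (length-cartesianProduct X X)
    (length≤cardℤ δ (Unique.cartesianProduct⁺ X! X!) into inj)
  where
  n = base h
  left right : Vec ℕ m × Vec ℕ m → Vec ℕ (m + m)
  left  (u , v) = pos h u Vec.++ neg h v
  right (u , v) = neg h u Vec.++ pos h v
  δ : Vec ℕ m × Vec ℕ m → ℤ
  δ uv = ℤ.+ val n (left uv) ℤ.- ℤ.+ val n (right uv)

  pos≤h : ∀ {k} {v : Vec ℕ k} → VecAll (_< n) v → VecAll (_≤ h) (pos h v)
  pos≤h = VecAll.map⁺ ∘ VecAll.map (digit∸h≤h h)
  neg≤h : ∀ {k} {v : Vec ℕ k} → VecAll (_< n) v → VecAll (_≤ h) (neg h v)
  neg≤h = VecAll.map⁺ ∘ VecAll.map (λ {d} _ → m∸n≤m h d)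

  into : ∀ {uv} → uv ∈ cartesianProduct X X → δ uv ∈ diffset (simplex h (m + m) L)
  into {u , v} uv∈ with ∈-cartesianProduct⁻ X X uv∈
  ... | u∈ , v∈ with spec u∈ | spec v∈
  ... | u<n , pu , qu | v<n , pv , qv = ∈-diffset⁺
    (∈-simplex⁺ h L (VecAll.++⁺ (pos≤h u<n) (neg≤h v<n))
      (≤-trans (≤-reflexive (trans (Vec.sum-++ (pos h u)) (cong₂ _+_ pu qv))) p+q≤L))
    (∈-simplex⁺ h L (VecAll.++⁺ (neg≤h u<n) (pos≤h v<n))
      (≤-trans (≤-reflexive (trans (Vec.sum-++ (neg h u)) (trans (cong₂ _+_ qu pv) (+-comm q p)))) p+q≤L))

  H N : ℕ
  H = val n (replicate m h)
  N = n ^ m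
  -- A subtraction-free form of δ(u, v) = (val u - H) - N (val v - H).
  balance : ∀ u v → val n (left (u , v)) + H + N * val n v ≡ val n (right (u , v)) + val n u + N * H
  balance u v rewrite val-++ n (pos h u) (neg h v) | val-++ n (neg h u) (pos h v) = begin
    val n (pos h u) + N * val n (neg h v) + H + N * val n v
      ≡⟨ eq₁ (val n (pos h u)) N (val n (neg h v)) H (val n v) ⟩
    val n (pos h u) + H + N * (val n (neg h v) + val n v)
      ≡⟨ cong₂ (λ x y → x + N * y) (val-balance n h u) (sym (val-balance n h v)) ⟩
    val n (neg h u) + val n u + N * (val n (pos h v) + H)
      ≡⟨ eq₂ (val n (neg h u)) (val n u) N (val n (pos h v)) H ⟩
    val n (neg h u) + N * val n (pos h v) + val n u + N * H
      ∎
    where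
    open ≡-Reasoning
    eq₁ : ∀ x N y H v → x + N * y + H + N * v ≡ x + H + N * (y + v)
    eq₁ = solve-∀
    eq₂ : ∀ x u N y H → x + u + N * (y + H) ≡ x + N * y + u + N * H
    eq₂ = solve-∀

  -- Up to a constant, δ(u, v) is val u - N val v. Exchanging `v` and `v′` across the equation
  -- removes the minus signs, and both sides become values of words with ordinary digits, to which
  -- `val-injective` applies.
  codes : ∀ u v u′ v′ → δ (u , v) ≡ δ (u′ , v′) → val n (u Vec.++ v′) ≡ val n (u′ Vec.++ v)
  codes u v u′ v′ eq rewrite val-++ n u v′ | val-++ n u′ v =
    +-cancelˡ-≡ (y + y′ + N * H + (x + y′) + H) _ _ (begin
      y + y′ + N * H + (x + y′) + H + (val n u + N * val n v′)
        ≡⟨ eq₁ y y′ (N * H) (x + y′) H (val n u) (N * val n v′) ⟩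
      (y + val n u + N * H) + y′ + (x + y′) + H + N * val n v′
        ≡⟨ cong₂ (λ s t → s + y′ + t + H + N * val n v′) (sym (balance u v)) cross ⟩
      (x + H + N * val n v) + y′ + (x′ + y) + H + N * val n v′
        ≡⟨ eq₂ x H (N * val n v) y′ x′ y (N * val n v′) ⟩
      (x′ + H + N * val n v′) + y + (x + y′) + H + N * val n v
        ≡⟨ cong (λ s → s + y + (x + y′) + H + N * val n v) (balance u′ v′) ⟩
      (y′ + val n u′ + N * H) + y + (x + y′) + H + N * val n v
        ≡⟨ eq₃ y′ (val n u′) (N * H) y (x + y′) H (N * val n v) ⟩
      y + y′ + N * H + (x + y′) + H + (val n u′ + N * val n v)
        ∎)
    where
    open ≡-Reasoning
    x  = val n (left (u , v))
    y  = val n (right (u , v))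
    x′ = val n (left (u′ , v′))
    y′ = val n (right (u′ , v′))
    cross : x + y′ ≡ x′ + y
    cross = -‿cross x y x′ y′ eq
    eq₁ : ∀ y y′ K s H u v → y + y′ + K + s + H + (u + v) ≡ (y + u + K) + y′ + s + H + v
    eq₁ = solve-∀
    eq₂ : ∀ x H v y′ x′ y v′ → (x + H + v) + y′ + (x′ + y) + H + v′ ≡ (x′ + H + v′) + y + (x + y′) + H + v
    eq₂ = solve-∀
    eq₃ : ∀ y′ u K y s H v → (y′ + u + K) + y + s + H + v ≡ y + y′ + K + s + H + (u + v)
    eq₃ = solve-∀

  inj : ∀ {uv uv′} → uv ∈ cartesianProduct X X → uv′ ∈ cartesianProduct X X → δ uv ≡ δ uv′ → uv ≡ uv′
  inj {u , v} {u′ , v′} uv∈ uv′∈ eq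
    with ∈-cartesianProduct⁻ X X uv∈ | ∈-cartesianProduct⁻ X X uv′∈
  ... | u∈ , v∈ | u′∈ , v′∈
    with Vec.++-injective u u′ (val-injective n
           (VecAll.++⁺ (proj₁ (spec u∈)) (proj₁ (spec v′∈)))
           (VecAll.++⁺ (proj₁ (spec u′∈)) (proj₁ (spec v∈)))
           (codes u v u′ v′ eq))
  ... | refl , refl = refl

-- Comparing the two bounds

^-distribʳ-* : ∀ x y e → (x * y) ^ e ≡ x ^ e * y ^ e
^-distribʳ-* x y zero    = refl
^-distribʳ-* x y (suc e) = trans (cong (x * y *_) (^-distribʳ-* x y e)) ([m*n]*[o*p]≡[m*o]*[n*p] x y (x ^ e) (y ^ e))

^-swap : ∀ x p q → (x ^ p) ^ q ≡ (x ^ q) ^ p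
^-swap x p q = trans (^-*-assoc x p q) (trans (cong (x ^_) (*-comm p q)) (sym (^-*-assoc x q p)))

-- The lower bound is squared because differences come from pairs of words. The powers of `a` and
-- `b` with exponent `l` then cancel with the common factor `D`. Of the shift from `l` to `suc l`,
-- the factor `a * a` is at least 1 and is dropped, while `b * b` joins the constant.
combine-bounds : ∀ h a b m l α β s c K .{{_ : NonZero a}} .{{_ : NonZero b}} →
  α ^ m * b ^ l ≤ K * K * (c * (a ^ l * (b ^ h) ^ m)) →
  s * (a ^ (suc l + suc l) * (b ^ (h + h)) ^ (m + m)) ≤ β ^ (m + m) * b ^ (suc l + suc l) →
  s * (b ^ h * α) ^ (m + m) ≤ b * b * (K * K * (K * K)) * (c * c) * β ^ (m + m)
combine-bounds h a b m l α β s c K lower upper = *-cancelʳ-≤ _ _ D (begin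
  s * (b ^ h * α) ^ (m + m) * D
    ≡⟨ cong (λ y → s * y * D) (trans (^-distribˡ-+-* (b ^ h * α) m m) (cong₂ _*_ Gx Gx)) ⟩
  s * (G * x * (G * x)) * D
    ≡⟨ eq₁ s G x P Q ⟩
  s * (P * P * G⁴) * (x * Q * (x * Q))
    ≤⟨ *-mono-≤ (*-monoʳ-≤ s (*-monoˡ-≤ G⁴ (*-mono-≤ (m≤n*m P a) (m≤n*m P a)))) (*-mono-≤ lower lower) ⟩
  s * (a * P * (a * P) * G⁴) * (F * F)
    ≤⟨ *-monoˡ-≤ (F * F) upper′ ⟩
  z * (b * Q * (b * Q)) * (F * F)
    ≡⟨ eq₂ z b Q K c P G ⟩
  b * b * (K * K * (K * K)) * (c * c) * z * D
    ∎)
  where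
  open ≤-Reasoning
  P = a ^ l
  Q = b ^ l
  G = (b ^ h) ^ m
  G⁴ = G * G * (G * G)
  x = α ^ m
  z = β ^ (m + m)
  F = K * K * (c * (P * G))
  D = P * P * (G * G) * (Q * Q)
  instance
    P≢0 : NonZero P
    P≢0 = m^n≢0 a l
    Q≢0 : NonZero Q
    Q≢0 = m^n≢0 b l
    G≢0 : NonZero G
    G≢0 = m^n≢0 (b ^ h) m {{m^n≢0 b h}}
    PP≢0 : NonZero (P * P)
    PP≢0 = m*n≢0 P P
    QQ≢0 : NonZero (Q * Q)
    QQ≢0 = m*n≢0 Q Q
    GG≢0 : NonZero (G * G)
    GG≢0 = m*n≢0 G G
    PPGG≢0 : NonZero (P * P * (G * G))
    PPGG≢0 = m*n≢0 (P * P) (G * G)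
    D≢0 : NonZero D
    D≢0 = m*n≢0 (P * P * (G * G)) (Q * Q)
  Gx : (b ^ h * α) ^ m ≡ G * x
  Gx = ^-distribʳ-* (b ^ h) α m
  GG : (b ^ (h + h)) ^ m ≡ G * G
  GG = trans (cong (_^ m) (^-distribˡ-+-* b h h)) (^-distribʳ-* (b ^ h) (b ^ h) m)
  upper′ : s * (a * P * (a * P) * G⁴) ≤ z * (b * Q * (b * Q))
  upper′ = subst₂ _≤_
    (cong (s *_) (cong₂ _*_ (^-distribˡ-+-* a (suc l) (suc l))
      (trans (^-distribˡ-+-* (b ^ (h + h)) m m) (cong₂ _*_ GG GG))))
    (cong (z *_) (^-distribˡ-+-* b (suc l) (suc l)))
    upper
  eq₁ : ∀ s G x P Q → s * (G * x * (G * x)) * (P * P * (G * G) * (Q * Q))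
                    ≡ s * (P * P * (G * G * (G * G))) * (x * Q * (x * Q))
  eq₁ = solve-∀
  eq₂ : ∀ z b Q K c P G → z * (b * Q * (b * Q)) * (K * K * (c * (P * G)) * (K * K * (c * (P * G))))
                        ≡ b * b * (K * K * (K * K)) * (c * c) * z * (P * P * (G * G) * (Q * Q))
  eq₂ = solve-∀

-- The constant E is absorbed by the factor 2 gained in each of the M coordinates.
absorb-constant : ∀ α β E M N n s T D e f .{{_ : NonZero α}} →
  s * α ^ M ≤ E * T * β ^ M → E ^ e ≤ 2 ^ M → 2 * (β ^ e * n ^ f) ≤ α ^ e →
  N ≤ n ^ M → T ≤ D → N ^ f * s ^ e ≤ D ^ e
absorb-constant α β E M N n s T D e f ratio E≤ gain N≤ T≤D =
  *-cancelʳ-≤ _ _ ((α ^ M) ^ e) {{m^n≢0 (α ^ M) e {{m^n≢0 α M}}}} (begin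
    N ^ f * s ^ e * (α ^ M) ^ e
      ≡⟨ *-assoc (N ^ f) _ _ ⟩
    N ^ f * (s ^ e * (α ^ M) ^ e)
      ≡⟨ cong (N ^ f *_) (^-distribʳ-* s (α ^ M) e) ⟨
    N ^ f * (s * α ^ M) ^ e
      ≤⟨ *-mono-≤ (^-monoˡ-≤ f N≤) (^-monoˡ-≤ e ratio) ⟩
    (n ^ M) ^ f * (E * T * β ^ M) ^ e
      ≡⟨ cong₂ _*_ (^-swap n M f) (trans (^-distribʳ-* (E * T) (β ^ M) e)
           (cong₂ _*_ (^-distribʳ-* E T e) (^-swap β M e))) ⟩
    (n ^ f) ^ M * (E ^ e * T ^ e * (β ^ e) ^ M)
      ≤⟨ *-monoʳ-≤ ((n ^ f) ^ M) (*-monoˡ-≤ ((β ^ e) ^ M) (*-mono-≤ E≤ (^-monoˡ-≤ e T≤D))) ⟩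
    (n ^ f) ^ M * (2 ^ M * D ^ e * (β ^ e) ^ M)
      ≡⟨ eq ((n ^ f) ^ M) (2 ^ M) (D ^ e) ((β ^ e) ^ M) ⟩
    D ^ e * (2 ^ M * ((β ^ e) ^ M * (n ^ f) ^ M))
      ≡⟨ cong (D ^ e *_) (trans (^-distribʳ-* 2 (β ^ e * n ^ f) M) (cong (2 ^ M *_) (^-distribʳ-* (β ^ e) (n ^ f) M))) ⟨
    D ^ e * (2 * (β ^ e * n ^ f)) ^ M
      ≤⟨ *-monoʳ-≤ (D ^ e) (^-monoˡ-≤ M gain) ⟩
    D ^ e * (α ^ e) ^ M
      ≡⟨ cong (D ^ e *_) (^-swap α e M) ⟩
    D ^ e * (α ^ M) ^ e
      ∎)
  where
  open ≤-Reasoning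
  eq : ∀ x y z w → x * (y * z * w) ≡ z * (y * (w * x))
  eq = solve-∀

-- With t = a / b these are b ^ (2h) times 1 + 2(t + … + t ^ h) and 1 + t + … + t ^ (2h) respectively.
Z⁻ Z⁺ : (h a b : ℕ) → ℕ
Z⁻ h a b = b ^ h * sum (map (weight a b h (λ d → (d ∸ h) + (h ∸ d))) (upTo (base h)))
Z⁺ h a b = sum (map (weight a b (h + h) id) (upTo (base h)))

-- This replaces the limit by a finite certificate for the exponent 1 + f / e: `gain` says that the
-- rate per coordinate beats f / e with a factor 2 to spare after taking `e`-th powers. The loss `E`
-- is polynomial in `m` and has at most about `g` bits, so `g * e ≤ m + m` lets the spare factors
-- cover `E ^ e`.
simplex-exponent : ∀ h a b m g e f
  .{{_ : NonZero a}} .{{_ : NonZero b}} .{{_ : NonZero m}} .{{_ : NonZero (Z⁻ h a b)}} →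
  1 ≤ h → a ≤ b →
  (let K = suc (m * h) in b * b * (K * K * (K * K)) ≤ 2 ^ g) →
  g * e ≤ m + m →
  2 * (Z⁺ h a b ^ e * base h ^ f) ≤ Z⁻ h a b ^ e →
  Σ (List ℕ) (λ U → (0 ∈ U) × (1 ≤ maxU U) ×
    ((2 * maxU U + 1) ^ f * cardℕ (sumset U) ^ e ≤ cardℤ (diffset U) ^ e))
simplex-exponent h a b m g e f 1≤h a≤b E≤2^g ge≤M gain =
  let p , q , X , X! , spec , lower = popular-class h m a b
      L = suc (p + q)
      U = simplex h M L
      s = cardℕ (sumset U)
  in
  U , 0∈simplex h M L , 1≤maxU-simplex h M L {{M≢0}} 1≤h (s≤s z≤n) ,
  absorb-constant (Z⁻ h a b) (Z⁺ h a b) E M (2 * maxU U + 1) (base h) s (length X * length X) (cardℤ (diffset U)) e f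
    (combine-bounds h a b m (p + q) α (Z⁺ h a b) s (length X) K lower (sumset-simplex-≤ h M L a b a≤b))
    E^e≤2^M gain (2*maxU-simplex+1≤ h M L)
    (diffset-simplex-≥ h L p q X X! spec (n≤1+n (p + q)))
  where
  open ≤-Reasoning
  M = m + m
  K = suc (m * h)
  E = b * b * (K * K * (K * K))
  α = sum (map (weight a b h (λ d → (d ∸ h) + (h ∸ d))) (upTo (base h)))
  M≢0 : NonZero M
  M≢0 = >-nonZero (≤-trans (>-nonZero⁻¹ m) (m≤m+n m m))
  E^e≤2^M : E ^ e ≤ 2 ^ M
  E^e≤2^M = begin
    E ^ e         ≤⟨ ^-monoˡ-≤ e E≤2^g ⟩
    (2 ^ g) ^ e   ≡⟨ ^-*-assoc 2 g e ⟩
    2 ^ (g * e)   ≤⟨ ^-monoʳ-≤ 2 ge≤M ⟩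
    2 ^ M         ∎

mainTheorem1 : Σ (List ℕ) (λ U →
    (0 ∈ U) × (1 ≤ maxU U) ×
    ((2 * maxU U + 1) ^ 3461 * cardℕ (sumset U) ^ 20000 ≤ cardℤ (diffset U) ^ 20000))
-- 64 (5m + 1)⁴ ≤ 2 ^ 98 and 98 · 20000 ≤ 2m at m = 2 ^ 20
mainTheorem1 = simplex-exponent 5 5 8 (2 ^ 20) 98 20000 3461 (≤ᵇ⇒≤ _ _ _) (≤ᵇ⇒≤ _ _ _)
  -- The last check is `gain` with 3461 / 20000 = 0.17305. At t = 5/8 the rate is about 0.173076,
  -- and 20000 is large enough for this margin to yield the factor 2.
  (≤ᵇ⇒≤ _ _ _) (≤ᵇ⇒≤ _ _ _) (≤ᵇ⇒≤ _ _ _)
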